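{- For all connected graphs $G$ and $H$ on $n$ vertices, either $X_G-X_H=0$ or $X_G-X_H$ is not $e$-positive.
   Context: All graphs are finite and simple. The chromatic symmetric function of a graph $G$ with vertices $v_1,\dots,v_n$ is $X_G=\sum_{\kappa}x_{\kappa(v_1)}\cdots x_{\kappa(v_n)}$, summed over all proper colorings $\kappa:V(G)\to\{1,2,3,\dots\}$ (adjacent vertices get different colors); it is a homogeneous symmetric function of degree $n$ in commuting variables $x_1,x_2,\dots$ over $\mathbb{Q}$. A symmetric function is $e$-positive if it is a linear combination of the elementary symmetric functions $e_\lambda=e_{\lambda_1}e_{\lambda_2}\cdots$ ($\lambda$ an integer partition) with non-negative coefficients. -}

module Defs where

open import Level using (0ℓ)
open import Data.Bool.Base using (if_then_else_)
open import Data.Nat.Base using (ℕ; zero; suc; _∸_; _≥_; _>_)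
import Data.Nat.Properties as ℕ
open import Data.Integer.Base using (+_)
open import Data.Rational.Base as ℚ using (ℚ; 0ℚ; 1ℚ; _/_)
open import Data.Fin.Base using (Fin)
open import Data.Fin.Properties as Fin using (all?)
open import Data.List.Base using (List; []; _∷_; map; foldr; filter; length; upTo; allFin; cartesianProductWith)
open import Data.List.Relation.Unary.All using (All)
open import Data.List.Relation.Unary.Linked using (Linked)
open import Data.Vec.Base as Vec using (Vec; []; _∷_; lookup; tabulate; count)
open import Data.Vec.Properties using (≡-dec)
import Data.Vec.Relation.Unary.All as VecAll
open import Data.Product.Base using (Σ-syntax; _×_; _,_; proj₁; proj₂)
open import Relation.Binary.Core using (Rel)
open import Relation.Binary.Definitions using (Symmetric; Irreflexive; Decidable)
open import Relation.Binary.Construct.Closure.ReflexiveTransitive using (Star)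
open import Relation.Binary.PropositionalEquality using (_≡_; _≢_)
open import Relation.Nullary.Decidable using (Dec; does; _×-dec_; _→-dec_; ¬?)

record Graph (n : ℕ) : Set₁ where
  field
    Adj    : Rel (Fin n) 0ℓ
    sym    : Symmetric Adj
    irrefl : Irreflexive _≡_ Adj
    adj?   : Decidable Adj

open Graph public

Connected : ∀ {n} → Graph n → Set
Connected G = ∀ u v → Star (Adj G) u v

-- Formal power series over ℚ in countably many variables x₁, x₂, …, given by
-- their coefficients: f k α is the coefficient of x₁^α₁ ⋯ x_k^α_k.  An exponent
-- vector and its extensions by trailing zeros name the same monomial; every
-- series constructed below assigns them the same coefficient.
Series : Set
Series = ∀ k → Vec ℕ k → ℚ

infix  4 _≈_
infixl 6 _+ˢ_ _-ˢ_
infixl 7 _*ˢ_ _·ˢ_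

_≈_ : Series → Series → Set
f ≈ g = ∀ k α → f k α ≡ g k α

0ˢ : Series
0ˢ k α = 0ℚ

1ˢ : Series
1ˢ k α = if does (VecAll.all? (ℕ._≟ 0) α) then 1ℚ else 0ℚ

_+ˢ_ : Series → Series → Series
(f +ˢ g) k α = f k α ℚ.+ g k α

_-ˢ_ : Series → Series → Series
(f -ˢ g) k α = f k α ℚ.- g k α

_·ˢ_ : ℚ → Series → Series
(c ·ˢ f) k α = c ℚ.* f k α

-- All pairs (β , γ) with β + γ = α componentwise.
splits : ∀ {k} → Vec ℕ k → List (Vec ℕ k × Vec ℕ k)
splits []      = ([] , []) ∷ []
splits (a ∷ α) =
  cartesianProductWith (λ i s → (i ∷ proj₁ s) , (a ∸ i ∷ proj₂ s))
                       (upTo (suc a)) (splits α)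

_*ˢ_ : Series → Series → Series
(f *ˢ g) k α = foldr ℚ._+_ 0ℚ (map (λ s → f k (proj₁ s) ℚ.* g k (proj₂ s)) (splits α))

colourings : ∀ n k → List (Vec (Fin k) n)
colourings zero    k = [] ∷ []
colourings (suc n) k = cartesianProductWith _∷_ (allFin k) (colourings n k)

Proper : ∀ {n k} → Graph n → Vec (Fin k) n → Set
Proper G κ = ∀ u v → Adj G u v → lookup κ u ≢ lookup κ v

proper? : ∀ {n k} (G : Graph n) (κ : Vec (Fin k) n) → Dec (Proper G κ)
proper? G κ = all? λ u → all? λ v →
  adj? G u v →-dec ¬? (lookup κ u Fin.≟ lookup κ v)

-- The exponent vector of the monomial x_{κ(v₁)} ⋯ x_{κ(vₙ)}.
content : ∀ {n k} → Vec (Fin k) n → Vec ℕ k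
content κ = tabulate λ c → count (Fin._≟ c) κ

-- A colouring by positive integers contributing to x₁^α₁ ⋯ x_k^α_k uses only
-- the colours 1, …, k, so it suffices to count colourings by Fin k.
X : ∀ {n} → Graph n → Series
X {n} G k α =
  + length (filter (λ κ → proper? G κ ×-dec ≡-dec ℕ._≟_ (content κ) α)
                   (colourings n k)) / 1

record Partition : Set where
  field
    parts      : List ℕ
    positive   : All (_> 0) parts
    decreasing : Linked _≥_ parts

open Partition public

-- The sum of all squarefree monomials of degree r.
e : ℕ → Series
e r k α = if does (VecAll.all? (ℕ._≤? 1) α ×-dec (Vec.sum α ℕ.≟ r)) then 1ℚ else 0ℚ

e[_] : Partition → Series
e[ λs ] = foldr _*ˢ_ 1ˢ (map e (parts λs))

eCombination : List (ℚ × Partition) → Series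
eCombination = foldr (λ t f → proj₁ t ·ˢ e[ proj₂ t ] +ˢ f) 0ˢ

EPositive : Series → Set
EPositive f = Σ[ cs ∈ List (ℚ × Partition) ]
  All (λ t → 0ℚ ℚ.≤ proj₁ t) cs × f ≈ eCombination cs

{-# OPTIONS --safe #-}

-- Look at the coefficient of x₁ ⋯ x_m.  A colouring with this content is
-- injective, hence proper for every graph, so the coefficient is the same in
-- X_G and X_H.  In every e_λ it is non-negative, and it is positive when m = |λ|.
-- So in a non-negative e-expansion of X_G − X_H all coefficients vanish.
-- Constructively one also has to decide whether X_G = X_H; removing unused
-- variables reduces this to the contents of colourings with at most n colours.
module Submission where

open import Defs
open import Data.Nat.Base using (ℕ)
open import Data.Sum.Base using (_⊎_)
open import Relation.Nullary.Negation.Core using (¬_)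

open import Algebra.Properties.Group using (x∙y⁻¹≈ε⇒x≈y)
open import Data.Bool.Base using (if_then_else_)
open import Data.Fin.Base using (Fin; zero; suc; punchIn; punchOut)
import Data.Fin.Properties as Fin
open import Data.Integer.Base using (+_)
open import Data.List.Base using (List; []; _∷_; foldr; length; map; filter)
open import Data.List.Membership.Propositional using (_∈_; find; lose)
open import Data.List.Membership.Propositional.Properties
  using (∈-cartesianProductWith⁺; ∈-allFin; ∈-upTo⁺; ∈-filter⁺; ∈-filter⁻; ∈-map⁺; ∈-map⁻)
open import Data.List.Membership.Propositional.Properties.WithK using (unique∧set⇒bag)
open import Data.List.Properties using (length-map; filter-≐)
open import Data.List.Relation.Binary.BagAndSetEquality using (∼bag⇒↭)
open import Data.List.Relation.Binary.Permutation.Propositional.Properties using (↭-length)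
open import Data.List.Relation.Unary.All as All using (All; []; _∷_)
open import Data.List.Relation.Unary.Any as Any using (Any; here; there)
import Data.List.Relation.Unary.AllPairs as AllPairs
open import Data.List.Relation.Unary.Unique.Propositional using (Unique)
import Data.List.Relation.Unary.Unique.Propositional.Properties as Unique
open import Data.Nat.Base using (zero; suc; _+_; _∸_; _<_; _≤_; z≤n; s≤s)
import Data.Nat.ListAction as ListAction
import Data.Nat.Properties as ℕ
open import Data.Product.Base using (∃; ∃₂; _×_; _,_; proj₁; proj₂)
open import Data.Rational.Base as ℚ using (ℚ; 0ℚ; 1ℚ; _/_)
import Data.Rational.Properties as ℚ
open import Data.Sum.Base using (inj₁; inj₂)
open import Data.Vec.Base as Vec using (Vec; []; _∷_; lookup; tabulate; count; insertAt; removeAt; replicate)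
open import Data.Vec.Properties
  using (≡-dec; ∷-injective; lookup∘tabulate; tabulate∘lookup; tabulate-cong; lookup-map;
         insertAt-lookup; insertAt-punchIn; removeAt-insertAt; insertAt-removeAt;
         lookup-replicate)
open import Data.Vec.Relation.Unary.All as VecAll using ([]; _∷_)
open import Function.Base using (_∘_)
open import Function.Bundles using (_⇔_; mk⇔; Equivalence)
open import Function.Definitions using (Injective)
open import Level using (Level)
open import Relation.Binary.PropositionalEquality
  using (_≡_; _≢_; refl; trans; cong; cong₂; subst; module ≡-Reasoning)
  renaming (sym to ≡-sym)
open import Relation.Nullary.Decidable using (Dec; yes; no; does; dec-true; _×-dec_)
open import Relation.Nullary.Negation using (contradiction)
open import Relation.Unary using (Pred; Decidable)

private variable
  a p : Level
  A : Set a
  k m n : ℕ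

-- Occurrence counts and contents of vectors.

module _ {P : Pred A p} (P? : Decidable P) where

  count>0⁺ : (xs : Vec A n) (i : Fin n) → P (lookup xs i) → 0 < count P? xs
  count>0⁺ (x ∷ xs) zero px with P? x
  ... | yes _ = s≤s z≤n
  ... | no ¬px = contradiction px ¬px
  count>0⁺ (x ∷ xs) (suc i) px with P? x
  ... | yes _ = s≤s z≤n
  ... | no _ = count>0⁺ xs i px

  count>0⁻ : (xs : Vec A n) → 0 < count P? xs → ∃ λ i → P (lookup xs i)
  count>0⁻ (x ∷ xs) 0<c with P? x
  ... | yes px = zero , px
  ... | no _ with i , pi ← count>0⁻ xs 0<c = suc i , pi

  count≤1⇒unique : (xs : Vec A n) → count P? xs ≤ 1 → (i j : Fin n) →
                   P (lookup xs i) → P (lookup xs j) → i ≡ j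
  count≤1⇒unique (x ∷ xs) c≤1 zero zero pi pj = refl
  count≤1⇒unique (x ∷ xs) c≤1 zero (suc j) pi pj with P? x
  ... | yes _ = contradiction (count>0⁺ xs j pj) (ℕ.≤⇒≯ (ℕ.≤-pred c≤1))
  ... | no ¬px = contradiction pi ¬px
  count≤1⇒unique (x ∷ xs) c≤1 (suc i) zero pi pj with P? x
  ... | yes _ = contradiction (count>0⁺ xs i pi) (ℕ.≤⇒≯ (ℕ.≤-pred c≤1))
  ... | no ¬px = contradiction pj ¬px
  count≤1⇒unique (x ∷ xs) c≤1 (suc i) (suc j) pi pj with P? x
  -- The head already accounts for the only occurrence, so this case is impossible. Weakening the
  -- bound on the tail from 0 to 1 lets the recursion dispose of it.
  ... | yes _ = cong suc (count≤1⇒unique xs (ℕ.m≤n⇒m≤1+n (ℕ.≤-pred c≤1)) i j pi pj)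
  ... | no _ = cong suc (count≤1⇒unique xs c≤1 i j pi pj)

lookup-content : (κ : Vec (Fin k) n) (c : Fin k) →
                 lookup (content κ) c ≡ count (Fin._≟ c) κ
lookup-content κ = lookup∘tabulate _

lookup-extensional : {xs ys : Vec A n} → (∀ i → lookup xs i ≡ lookup ys i) → xs ≡ ys
lookup-extensional {xs = xs} {ys} eq = begin
  xs                   ≡⟨ tabulate∘lookup xs ⟨
  tabulate (lookup xs) ≡⟨ tabulate-cong eq ⟩
  tabulate (lookup ys) ≡⟨ tabulate∘lookup ys ⟩
  ys                   ∎
  where open ≡-Reasoning

map-injective : ∀ {b} {B : Set b} {f : A → B} → Injective _≡_ _≡_ f →
                Injective _≡_ _≡_ (Vec.map {n = n} f)
map-injective {f = f} f-inj {xs} {ys} eq = lookup-extensional λ i → f-inj (begin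
  f (lookup xs i)         ≡⟨ lookup-map i f xs ⟨
  lookup (Vec.map f xs) i ≡⟨ cong (λ zs → lookup zs i) eq ⟩
  lookup (Vec.map f ys) i ≡⟨ lookup-map i f ys ⟩
  f (lookup ys i)         ∎)
  where open ≡-Reasoning

-- Colourings and the coefficients they determine.

∈-colourings : (κ : Vec (Fin k) n) → κ ∈ colourings n k
∈-colourings []      = here refl
∈-colourings (c ∷ κ) = ∈-cartesianProductWith⁺ _∷_ (∈-allFin c) (∈-colourings κ)

-- Together with `∈-colourings` this makes the length of a filtered list a true count, so that
-- bijections between colourings give equal coefficients.
colourings-unique : ∀ n k → Unique (colourings n k)
colourings-unique zero    k = [] AllPairs.∷ AllPairs.[]
colourings-unique (suc n) k =
  Unique.cartesianProductWith⁺ _∷_ ∷-injective (Unique.allFin⁺ k) (colourings-unique n k)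

-- Only colourings of content `α` are counted at `α`. The hypothesis may also hold vacuously: this
-- is how exponent vectors that are the content of no colouring are handled later.
X-local : (G H : Graph n) (α : Vec ℕ k) →
          (∀ κ → content κ ≡ α → Proper G κ ⇔ Proper H κ) → X G k α ≡ X H k α
X-local {n} {k} G H α same = cong (λ l → + length l / 1) (filter-≐
  (λ κ → proper? G κ ×-dec ≡-dec ℕ._≟_ (content κ) α)
  (λ κ → proper? H κ ×-dec ≡-dec ℕ._≟_ (content κ) α)
  ( (λ {κ} (pG , eq) → Equivalence.to (same κ eq) pG , eq)
  , (λ {κ} (pH , eq) → Equivalence.from (same κ eq) pH , eq))
  (colourings n k))

-- Every `m` is covered, not only `m = n`, because the partitions in an e-combination may have any
-- size.
X-local-ones : (G H : Graph n) → ∀ m → X G m (replicate m 1) ≡ X H m (replicate m 1)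
X-local-ones G H m = X-local G H (replicate m 1) λ κ eq →
  mk⇔ (λ _ → proper H κ eq) (λ _ → proper G κ eq)
  where
  proper : (F : Graph n) (κ : Vec (Fin m) n) → content κ ≡ replicate m 1 → Proper F κ
  proper F κ eq u v adj κu≡κv = irrefl F
    (count≤1⇒unique (Fin._≟ lookup κ v) κ (ℕ.≤-reflexive (begin
      count (Fin._≟ lookup κ v) κ        ≡⟨ lookup-content κ (lookup κ v) ⟨
      lookup (content κ) (lookup κ v)    ≡⟨ cong (λ α → lookup α (lookup κ v)) eq ⟩
      lookup (replicate m 1) (lookup κ v) ≡⟨ lookup-replicate (lookup κ v) 1 ⟩
      1                                  ∎)) u v κu≡κv refl)
    adj
    where open ≡-Reasoning

count-map-punchIn : (i : Fin (suc k)) (c : Fin k) (κ : Vec (Fin k) n) →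
                    count (Fin._≟ punchIn i c) (Vec.map (punchIn i) κ) ≡ count (Fin._≟ c) κ
count-map-punchIn i c []      = refl
count-map-punchIn i c (d ∷ κ) with punchIn i d Fin.≟ punchIn i c | d Fin.≟ c
... | yes _ | yes _ = cong suc (count-map-punchIn i c κ)
... | no _  | no _  = count-map-punchIn i c κ
... | yes q | no d≢c = contradiction (Fin.punchIn-injective i d c q) d≢c
... | no q  | yes refl = contradiction refl q

-- The renaming `punchIn i` misses exactly the colour `i`, which accounts for the inserted 0. Being
-- injective, it preserves the multiplicities of all other colours.
content-map-punchIn : (i : Fin (suc k)) (κ : Vec (Fin k) n) →
                      content (Vec.map (punchIn i) κ) ≡ insertAt (content κ) i 0
content-map-punchIn i κ = lookup-extensional λ j →
  trans (lookup-content (Vec.map (punchIn i) κ) j) (counts j)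
  where
  open ≡-Reasoning
  unused : count (Fin._≟ i) (Vec.map (punchIn i) κ) ≡ 0
  unused = ℕ.n≤0⇒n≡0 (ℕ.≮⇒≥ λ 0<c →
    let u , eq = count>0⁻ (Fin._≟ i) (Vec.map (punchIn i) κ) 0<c in
    Fin.punchInᵢ≢i i (lookup κ u) (trans (≡-sym (lookup-map u (punchIn i) κ)) eq))
  counts : ∀ j → count (Fin._≟ j) (Vec.map (punchIn i) κ) ≡ lookup (insertAt (content κ) i 0) j
  counts j with i Fin.≟ j
  ... | yes refl = trans unused (≡-sym (insertAt-lookup (content κ) i 0))
  ... | no i≢j = subst
    (λ j → count (Fin._≟ j) (Vec.map (punchIn i) κ) ≡ lookup (insertAt (content κ) i 0) j)
    (Fin.punchIn-punchOut i≢j) (begin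
      count (Fin._≟ punchIn i c) (Vec.map (punchIn i) κ) ≡⟨ count-map-punchIn i c κ ⟩
      count (Fin._≟ c) κ                                 ≡⟨ lookup-content κ c ⟨
      lookup (content κ) c                               ≡⟨ insertAt-punchIn (content κ) i 0 c ⟨
      lookup (insertAt (content κ) i 0) (punchIn i c)    ∎)
    where c = punchOut i≢j

insertAt-injective : (i : Fin (suc k)) (x : A) → Injective _≡_ _≡_ (λ xs → insertAt xs i x)
insertAt-injective i x {xs} {ys} eq = begin
  xs                            ≡⟨ removeAt-insertAt xs i x ⟨
  removeAt (insertAt xs i x) i  ≡⟨ cong (λ zs → removeAt zs i) eq ⟩
  removeAt (insertAt ys i x) i  ≡⟨ removeAt-insertAt ys i x ⟩
  ys                            ∎
  where open ≡-Reasoning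

-- Colour `i` has multiplicity 0, so every colour in use can be pulled back by `punchOut`. This is
-- the surjectivity needed in `X-insertAt-0`.
content-insertAt-0 : (i : Fin (suc k)) (α : Vec ℕ k) (κ : Vec (Fin (suc k)) n) →
                     content κ ≡ insertAt α i 0 → ∃ λ κ′ → κ ≡ Vec.map (punchIn i) κ′
content-insertAt-0 i α κ eq = tabulate κ′ , lookup-extensional λ u → begin
  lookup κ u                                   ≡⟨ Fin.punchIn-punchOut (i≢κ u) ⟨
  punchIn i (κ′ u)                             ≡⟨ cong (punchIn i) (lookup∘tabulate κ′ u) ⟨
  punchIn i (lookup (tabulate κ′) u)           ≡⟨ lookup-map u (punchIn i) (tabulate κ′) ⟨
  lookup (Vec.map (punchIn i) (tabulate κ′)) u ∎
  where
  open ≡-Reasoning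
  unused : count (Fin._≟ i) κ ≡ 0
  unused = begin
    count (Fin._≟ i) κ        ≡⟨ lookup-content κ i ⟨
    lookup (content κ) i      ≡⟨ cong (λ β → lookup β i) eq ⟩
    lookup (insertAt α i 0) i ≡⟨ insertAt-lookup α i 0 ⟩
    0                         ∎
  i≢κ : ∀ u → i ≢ lookup κ u
  i≢κ u i≡κu = ℕ.>⇒≢ (count>0⁺ (Fin._≟ i) κ u (≡-sym i≡κu)) unused
  κ′ : Fin _ → Fin _
  κ′ u = punchOut (i≢κ u)

proper-map : (G : Graph n) {f : Fin k → Fin m} → Injective _≡_ _≡_ f →
             (κ : Vec (Fin k) n) → Proper G κ ⇔ Proper G (Vec.map f κ)
proper-map G {f} f-inj κ = mk⇔
  (λ pr u v adj eq → pr u v adj (f-inj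
    (trans (≡-sym (lookup-map u f κ)) (trans eq (lookup-map v f κ)))))
  (λ pr u v adj eq → pr u v adj
    (trans (lookup-map u f κ) (trans (cong f eq) (≡-sym (lookup-map v f κ)))))

-- Renaming colours by `punchIn i` is a bijection between the proper colourings counted on the two
-- sides. Both lists are free of duplicates and have the same members, hence are permutations of
-- each other.
X-insertAt-0 : (G : Graph n) (i : Fin (suc k)) (α : Vec ℕ k) →
               X G (suc k) (insertAt α i 0) ≡ X G k α
X-insertAt-0 {n} {k} G i α = cong (λ l → + l / 1) (trans
  (↭-length (∼bag⇒↭ (unique∧set⇒bag
    (Unique.filter⁺ P? (colourings-unique n (suc k)))
    (Unique.map⁺ ι-injective (Unique.filter⁺ Q? (colourings-unique n k)))
    (mk⇔ to from))))
  (length-map ι (filter Q? (colourings n k))))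
  where
  P? = λ κ → proper? G κ ×-dec ≡-dec ℕ._≟_ (content κ) (insertAt α i 0)
  Q? = λ κ → proper? G κ ×-dec ≡-dec ℕ._≟_ (content κ) α
  ι : Vec (Fin k) n → Vec (Fin (suc k)) n
  ι = Vec.map (punchIn i)
  ι-injective : Injective _≡_ _≡_ ι
  ι-injective = map-injective (Fin.punchIn-injective i _ _)
  properι : ∀ κ → Proper G κ ⇔ Proper G (ι κ)
  properι = proper-map G (Fin.punchIn-injective i _ _)
  to : ∀ {κ} → κ ∈ filter P? (colourings n (suc k)) → κ ∈ map ι (filter Q? (colourings n k))
  to {κ} κ∈ with _ , pr , eq ← ∈-filter⁻ P? {xs = colourings n (suc k)} κ∈
            with κ′ , refl ← content-insertAt-0 i α κ eq
    = ∈-map⁺ ι (∈-filter⁺ Q? (∈-colourings κ′)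
        ( Equivalence.from (properι κ′) pr
        , insertAt-injective i 0 (trans (≡-sym (content-map-punchIn i κ′)) eq)))
  from : ∀ {κ} → κ ∈ map ι (filter Q? (colourings n k)) → κ ∈ filter P? (colourings n (suc k))
  from κ∈ with κ′ , κ′∈ , refl ← ∈-map⁻ ι κ∈
          with _ , pr , refl ← ∈-filter⁻ Q? {xs = colourings n k} κ′∈
    = ∈-filter⁺ P? (∈-colourings (ι κ′))
        (Equivalence.to (properι κ′) pr , content-map-punchIn i κ′)

-- Deciding whether the two chromatic symmetric functions agree.

¬content-nowhere-0 : n < k → (κ : Vec (Fin k) n) → ¬ (∀ c → lookup (content κ) c ≢ 0)
¬content-nowhere-0 n<k κ all≢0 = Fin.<⇒≢ i<j (begin
  i              ≡⟨ proj₂ (preimage i) ⟨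
  lookup κ (g i) ≡⟨ cong (lookup κ) gi≡gj ⟩
  lookup κ (g j) ≡⟨ proj₂ (preimage j) ⟩
  j              ∎)
  where
  open ≡-Reasoning
  preimage : ∀ c → ∃ λ u → lookup κ u ≡ c
  preimage c = count>0⁻ (Fin._≟ c) κ
    (subst (0 <_) (lookup-content κ c) (ℕ.n≢0⇒n>0 (all≢0 c)))
  g = proj₁ ∘ preimage
  -- `g` picks a vertex of each colour; with more colours than vertices, two colours share a vertex.
  collision = Fin.pigeonhole n<k g
  i = proj₁ collision
  j = proj₁ (proj₂ collision)
  i<j = proj₁ (proj₂ (proj₂ collision))
  gi≡gj = proj₂ (proj₂ (proj₂ collision))

-- Ranging over contents of colourings instead of all exponent vectors makes this a finite,
-- decidable check.
AgreeOn : (G H : Graph n) (k : ℕ) → Set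
AgreeOn {n} G H k = All (λ κ → X G k (content κ) ≡ X H k (content κ)) (colourings n k)

agreeOn? : (G H : Graph n) → Decidable (AgreeOn G H)
agreeOn? {n} G H k = All.all? (λ κ → X G k (content κ) ℚ.≟ X H k (content κ)) (colourings n k)

-- If `α` is the content of some colouring, the check covers it. Otherwise no colouring contributes
-- at `α`, and `X-local` applies vacuously.
agreeOn⇒≡ : (G H : Graph n) → AgreeOn G H k → (α : Vec ℕ k) → X G k α ≡ X H k α
agreeOn⇒≡ {n} {k} G H agree α =
  attained (Any.any? (λ κ → ≡-dec ℕ._≟_ (content κ) α) (colourings n k))
  where
  attained : Dec (Any (λ κ → content κ ≡ α) (colourings n k)) → X G k α ≡ X H k α
  attained (yes any) = let κ , κ∈ , eq = find any in
    subst (λ β → X G k β ≡ X H k β) eq (All.lookup agree κ∈)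
  attained (no none) = X-local G H α λ κ eq →
    contradiction (lose (∈-colourings κ) eq) none

-- A monomial of degree n involves at most n of the variables.
agreeOn≤n⇒≈ : (G H : Graph n) → (∀ {k} → k < suc n → AgreeOn G H k) → X G ≈ X H
agreeOn≤n⇒≈ G H agree zero α = agreeOn⇒≡ G H (agree (s≤s z≤n)) α
agreeOn≤n⇒≈ {n} G H agree (suc k) α =
  cases (suc k ℕ.≤? n) (Fin.any? λ c → lookup α c ℕ.≟ 0)
  where
  open ≡-Reasoning
  cases : Dec (suc k ≤ n) → Dec (∃ λ c → lookup α c ≡ 0) → X G (suc k) α ≡ X H (suc k) α
  cases (yes k<n) _ = agreeOn⇒≡ G H (agree (s≤s k<n)) α
  -- More than `n` variables, all with positive exponent: no colouring of `n` vertices has this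
  -- content.
  cases (no k≮n) (no none) = X-local G H α λ { κ refl →
    contradiction (λ c eq → none (c , eq)) (¬content-nowhere-0 (ℕ.≰⇒> k≮n) κ) }
  -- Deleting the variable with exponent 0 leaves `k` variables, so the recursion is on their
  -- number.
  cases (no _) (yes (i , αᵢ≡0)) = begin
    X G (suc k) α                ≡⟨ cong (X G (suc k)) α≡ ⟩
    X G (suc k) (insertAt β i 0) ≡⟨ X-insertAt-0 G i β ⟩
    X G k β                      ≡⟨ agreeOn≤n⇒≈ G H agree k β ⟩
    X H k β                      ≡⟨ X-insertAt-0 H i β ⟨
    X H (suc k) (insertAt β i 0) ≡⟨ cong (X H (suc k)) α≡ ⟨
    X H (suc k) α                ∎
    where
    β = removeAt α i
    α≡ : α ≡ insertAt β i 0
    α≡ = trans (≡-sym (insertAt-removeAt α i)) (cong (insertAt β i) αᵢ≡0)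

-- Non-negative rationals and series with non-negative coefficients.

0≤p*q : ∀ {p q} → 0ℚ ℚ.≤ p → 0ℚ ℚ.≤ q → 0ℚ ℚ.≤ p ℚ.* q
0≤p*q {p} {q} 0≤p 0≤q =
  ℚ.nonNegative⁻¹ (p ℚ.* q) {{ℚ.nonNeg*nonNeg⇒nonNeg p {{ℚ.nonNegative 0≤p}} q {{ℚ.nonNegative 0≤q}}}}

0<p*q : ∀ {p q} → 0ℚ ℚ.< p → 0ℚ ℚ.< q → 0ℚ ℚ.< p ℚ.* q
0<p*q {p} {q} 0<p 0<q =
  ℚ.positive⁻¹ (p ℚ.* q) {{ℚ.pos*pos⇒pos p {{ℚ.positive 0<p}} q {{ℚ.positive 0<q}}}}

module _ {f : A → ℚ} (f≥0 : ∀ x → 0ℚ ℚ.≤ f x) where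

  sum-nonNeg : (xs : List A) → 0ℚ ℚ.≤ foldr ℚ._+_ 0ℚ (map f xs)
  sum-nonNeg []       = ℚ.≤-refl
  sum-nonNeg (x ∷ xs) = ℚ.+-mono-≤ (f≥0 x) (sum-nonNeg xs)

  sum-pos : ∀ {x} (xs : List A) → x ∈ xs → 0ℚ ℚ.< f x → 0ℚ ℚ.< foldr ℚ._+_ 0ℚ (map f xs)
  sum-pos (x ∷ xs) (here refl) 0<fx = ℚ.+-mono-<-≤ 0<fx (sum-nonNeg xs)
  sum-pos (x ∷ xs) (there x∈)  0<fx = ℚ.+-mono-≤-< (f≥0 x) (sum-pos xs x∈ 0<fx)

NonNegˢ : Series → Set
NonNegˢ f = ∀ k α → 0ℚ ℚ.≤ f k α

indicator-nonNeg : ∀ {P : Set p} (P? : Dec P) → 0ℚ ℚ.≤ (if does P? then 1ℚ else 0ℚ)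
indicator-nonNeg (yes _) = ℚ.nonNegative⁻¹ 1ℚ
indicator-nonNeg (no _)  = ℚ.≤-refl

indicator-pos : ∀ {P : Set p} (P? : Dec P) → P → 0ℚ ℚ.< (if does P? then 1ℚ else 0ℚ)
indicator-pos P? px rewrite dec-true P? px = ℚ.positive⁻¹ 1ℚ

1ˢ-nonNeg : NonNegˢ 1ˢ
1ˢ-nonNeg k α = indicator-nonNeg (VecAll.all? (ℕ._≟ 0) α)

e-nonNeg : ∀ r → NonNegˢ (e r)
e-nonNeg r k α = indicator-nonNeg (VecAll.all? (ℕ._≤? 1) α ×-dec (Vec.sum α ℕ.≟ r))

*ˢ-nonNeg : ∀ {f g} → NonNegˢ f → NonNegˢ g → NonNegˢ (f *ˢ g)
*ˢ-nonNeg f≥0 g≥0 k α =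
  sum-nonNeg (λ (β , γ) → 0≤p*q (f≥0 k β) (g≥0 k γ)) (splits α)

-- Nothing cancels in the convolution, so one positive term is enough.
*ˢ-pos : ∀ {f g} → NonNegˢ f → NonNegˢ g → (α : Vec ℕ k) → ∀ {β γ} → (β , γ) ∈ splits α →
         0ℚ ℚ.< f k β → 0ℚ ℚ.< g k γ → 0ℚ ℚ.< (f *ˢ g) k α
*ˢ-pos {k} f≥0 g≥0 α βγ∈ 0<f 0<g =
  sum-pos (λ (β , γ) → 0≤p*q (f≥0 k β) (g≥0 k γ)) (splits α) βγ∈ (0<p*q 0<f 0<g)

product-nonNeg : (rs : List ℕ) → NonNegˢ (foldr _*ˢ_ 1ˢ (map e rs))
product-nonNeg []       = 1ˢ-nonNeg
product-nonNeg (r ∷ rs) = *ˢ-nonNeg (e-nonNeg r) (product-nonNeg rs)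

-- Positivity of `e[ μ ]` at squarefree monomials.

∈-splits : ∀ {i a} (α : Vec ℕ k) {β γ} → i ≤ a → (β , γ) ∈ splits α →
           (i ∷ β , a ∸ i ∷ γ) ∈ splits (a ∷ α)
∈-splits α i≤a βγ∈ = ∈-cartesianProductWith⁺ _ (∈-upTo⁺ (s≤s i≤a)) βγ∈

Squarefree : Vec ℕ k → Set
Squarefree = VecAll.All (_≤ 1)

-- The splitting is greedy: the first `r` variables that occur go to `β`, the remaining `s` to `γ`.
-- It supplies the positive term required by `*ˢ-pos`.
split-squarefree : ∀ r s {α : Vec ℕ k} → Squarefree α → Vec.sum α ≡ r + s →
  ∃₂ λ β γ → (β , γ) ∈ splits α ×
    (Squarefree β × Vec.sum β ≡ r) × (Squarefree γ × Vec.sum γ ≡ s)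
split-squarefree zero zero [] eq = [] , [] , here refl , ([] , refl) , ([] , refl)
split-squarefree r s {zero ∷ α} (_ ∷ sf) eq
  with β , γ , βγ∈ , (sfβ , eqβ) , (sfγ , eqγ) ← split-squarefree r s sf eq
  = 0 ∷ β , 0 ∷ γ , ∈-splits α z≤n βγ∈ , (z≤n ∷ sfβ , eqβ) , (z≤n ∷ sfγ , eqγ)
split-squarefree zero (suc s) {suc zero ∷ α} (_ ∷ sf) eq
  with β , γ , βγ∈ , (sfβ , eqβ) , (sfγ , eqγ) ← split-squarefree zero s sf (ℕ.suc-injective eq)
  = 0 ∷ β , 1 ∷ γ , ∈-splits α z≤n βγ∈ , (z≤n ∷ sfβ , eqβ) , (s≤s z≤n ∷ sfγ , cong suc eqγ)
split-squarefree (suc r) s {suc zero ∷ α} (_ ∷ sf) eq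
  with β , γ , βγ∈ , (sfβ , eqβ) , (sfγ , eqγ) ← split-squarefree r s sf (ℕ.suc-injective eq)
  = 1 ∷ β , 0 ∷ γ , ∈-splits α (s≤s z≤n) βγ∈ , (s≤s z≤n ∷ sfβ , cong suc eqβ) , (z≤n ∷ sfγ , eqγ)
split-squarefree r s {suc (suc _) ∷ α} (s≤s () ∷ sf) eq

sum≡0⇒all≡0 : (α : Vec ℕ k) → Vec.sum α ≡ 0 → VecAll.All (_≡ 0) α
sum≡0⇒all≡0 []      eq = []
sum≡0⇒all≡0 (a ∷ α) eq =
  ℕ.m+n≡0⇒m≡0 a eq ∷ sum≡0⇒all≡0 α (ℕ.m+n≡0⇒n≡0 a eq)

-- Repeated splitting deals the variables of `α` out to the factors, `r` of them to each `e r`, and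
-- every factor has coefficient 1 at its share.
product-pos : (rs : List ℕ) {α : Vec ℕ k} → Squarefree α → Vec.sum α ≡ ListAction.sum rs →
              0ℚ ℚ.< foldr _*ˢ_ 1ˢ (map e rs) k α
product-pos [] {α} sf eq = indicator-pos (VecAll.all? (ℕ._≟ 0) α) (sum≡0⇒all≡0 α eq)
product-pos (r ∷ rs) {α} sf eq =
  let β , γ , βγ∈ , onβ , sfγ , eqγ = split-squarefree r (ListAction.sum rs) sf eq in
    *ˢ-pos (e-nonNeg r) (product-nonNeg rs) α βγ∈
      (indicator-pos (VecAll.all? (ℕ._≤? 1) β ×-dec (Vec.sum β ℕ.≟ r)) onβ)
      (product-pos rs sfγ eqγ)

ones-squarefree : ∀ m → Squarefree (replicate m 1)
ones-squarefree zero    = []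
ones-squarefree (suc m) = ℕ.≤-refl ∷ ones-squarefree m

sum-ones : ∀ m → Vec.sum (replicate m 1) ≡ m
sum-ones zero    = refl
sum-ones (suc m) = cong suc (sum-ones m)

-- The size of `μ` fixes the test monomial: `e[ μ ]` is homogeneous of that degree.
e-pos-ones : (μ : Partition) → let m = ListAction.sum (parts μ) in
             0ℚ ℚ.< e[ μ ] m (replicate m 1)
e-pos-ones μ = product-pos (parts μ) (ones-squarefree _) (sum-ones _)

-- Non-negative e-combinations vanishing at the test monomials.

NonNegCoeffs : List (ℚ × Partition) → Set
NonNegCoeffs = All (λ t → 0ℚ ℚ.≤ proj₁ t)

eCombination-nonNeg : ∀ {cs} → NonNegCoeffs cs → NonNegˢ (eCombination cs)
eCombination-nonNeg []           k α = ℚ.≤-refl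
eCombination-nonNeg {(c , μ) ∷ cs} (c≥0 ∷ cs≥0) k α =
  ℚ.+-mono-≤ (0≤p*q c≥0 (product-nonNeg (parts μ) k α)) (eCombination-nonNeg cs≥0 k α)

p+q≡0⇒p≡0 : ∀ {p q} → 0ℚ ℚ.≤ p → 0ℚ ℚ.≤ q → p ℚ.+ q ≡ 0ℚ → p ≡ 0ℚ
p+q≡0⇒p≡0 {p} {q} 0≤p 0≤q eq = ℚ.≤-antisym (begin
  p           ≡⟨ ℚ.+-identityʳ p ⟨
  p ℚ.+ 0ℚ    ≤⟨ ℚ.+-monoʳ-≤ p 0≤q ⟩
  p ℚ.+ q     ≡⟨ eq ⟩
  0ℚ          ∎) 0≤p
  where open ℚ.≤-Reasoning

p*q≡0⇒p≡0 : ∀ {p q} → 0ℚ ℚ.≤ p → 0ℚ ℚ.< q → p ℚ.* q ≡ 0ℚ → p ≡ 0ℚ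
p*q≡0⇒p≡0 0≤p 0<q eq = ℚ.≤-antisym
  (ℚ.≮⇒≥ λ 0<p → ℚ.<⇒≢ (0<p*q 0<p 0<q) (≡-sym eq)) 0≤p

-- Head term and tail are both non-negative, so neither can cancel the other: where the sum is 0,
-- both are 0. This kills the first coefficient and passes the hypothesis on to the tail.
eCombination-vanishes : ∀ {cs} → NonNegCoeffs cs →
  (∀ m → eCombination cs m (replicate m 1) ≡ 0ℚ) → eCombination cs ≈ 0ˢ
eCombination-vanishes [] _ k α = refl
eCombination-vanishes {(c , μ) ∷ cs} (c≥0 ∷ cs≥0) at-ones k α = begin
  c ℚ.* e[ μ ] k α ℚ.+ eCombination cs k α ≡⟨ cong₂ (λ p q → p ℚ.* e[ μ ] k α ℚ.+ q) c≡0 cs≈0 ⟩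
  0ℚ ℚ.* e[ μ ] k α ℚ.+ 0ℚ                 ≡⟨ ℚ.+-identityʳ (0ℚ ℚ.* e[ μ ] k α) ⟩
  0ℚ ℚ.* e[ μ ] k α                        ≡⟨ ℚ.*-zeroˡ (e[ μ ] k α) ⟩
  0ℚ                                       ∎
  where
  open ≡-Reasoning
  head≥0 : ∀ m → 0ℚ ℚ.≤ c ℚ.* e[ μ ] m (replicate m 1)
  head≥0 m = 0≤p*q c≥0 (product-nonNeg (parts μ) m (replicate m 1))
  tail≥0 : ∀ m → 0ℚ ℚ.≤ eCombination cs m (replicate m 1)
  tail≥0 m = eCombination-nonNeg cs≥0 m (replicate m 1)
  c≡0 : c ≡ 0ℚ
  -- The omitted arguments are the size of `μ`, where its coefficient is known to be positive.
  c≡0 = p*q≡0⇒p≡0 c≥0 (e-pos-ones μ) (p+q≡0⇒p≡0 (head≥0 _) (tail≥0 _) (at-ones _))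
  tail≡0 : ∀ m → eCombination cs m (replicate m 1) ≡ 0ℚ
  tail≡0 m = p+q≡0⇒p≡0 (tail≥0 m) (head≥0 m)
    (trans (ℚ.+-comm (eCombination cs m (replicate m 1)) _) (at-ones m))
  cs≈0 : eCombination cs k α ≡ 0ℚ
  cs≈0 = eCombination-vanishes cs≥0 tail≡0 k α

ePositive-vanishes : ∀ {f} → EPositive f → (∀ m → f m (replicate m 1) ≡ 0ℚ) → f ≈ 0ˢ
ePositive-vanishes (cs , cs≥0 , f≈) at-ones k α = trans (f≈ k α)
  (eCombination-vanishes cs≥0 (λ m → trans (≡-sym (f≈ m _)) (at-ones m)) k α)

-- The dichotomy.

p≡q⇒p-q≡0 : ∀ {p q} → p ≡ q → p ℚ.- q ≡ 0ℚ
p≡q⇒p-q≡0 {p} refl = ℚ.+-inverseʳ p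

theorem2p16 : (n : ℕ) (G H : Graph n) → Connected G → Connected H →
    ((X G -ˢ X H) ≈ 0ˢ) ⊎ (¬ EPositive (X G -ˢ X H))
-- The bound is strict, so `suc n` makes the search include `k = n`.
theorem2p16 n G H _ _ = decide (ℕ.allUpTo? (agreeOn? G H) (suc n))
  where
  decide : Dec (∀ {k} → k < suc n → AgreeOn G H k) →
           ((X G -ˢ X H) ≈ 0ˢ) ⊎ (¬ EPositive (X G -ˢ X H))
  decide (yes agree) = inj₁ λ k α → p≡q⇒p-q≡0 (agreeOn≤n⇒≈ G H agree k α)
  -- An e-positive difference would vanish identically, giving the agreement that `disagree`
  -- refutes.
  decide (no disagree) = inj₂ λ pos → disagree λ {k} _ → All.tabulate λ {κ} _ →
    x∙y⁻¹≈ε⇒x≈y ℚ.+-0-group _ _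
      (ePositive-vanishes pos (λ m → p≡q⇒p-q≡0 (X-local-ones G H m)) k (content κ))
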